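{- For every integer $k\geq 3$, $$\operatorname{gr}_k(P_5:S_6^1)= \begin{cases} 26, & k=3;\\ 7, & 4\leq k\leq 6;\\ \left\lceil\frac{1+\sqrt{1+8k}}{2}\right\rceil, & k\geq 7. \end{cases}$$
   Context: All graphs are finite, simple and undirected. $K_n$ is the complete graph on $n$ vertices and $P_5$ is the path with $5$ vertices and $4$ edges. $S_t^r$ is the graph of order $t$ obtained from the star $K_{1,t-1}$ by adding $r$ pairwise independent edges between the leaves; thus $S_6^1$ is the star $K_{1,5}$ with one edge added between two leaves. A $k$-edge-coloring assigns to each edge one of $k$ colors; all $k$-edge-colorings are assumed exact, i.e. each of the $k$ colors is used at least once. An edge-colored graph is rainbow if all its edges have different colors and monochromatic if all its edges have a single color. A copy of a graph means a (not necessarily induced) subgraph isomorphic to it. For non-empty graphs $G,H$ (graphs with at least one edge) and a positive integer $k$, the Gallai-Ramsey number $\operatorname{gr}_k(G:H)$ is the minimum integer $N$ with $\binom{N}{2}\geq k$ (so that $K_N$ admits a $k$-edge-coloring) such that for all $n\geq N$, every $k$-edge-coloring of $K_n$ contains either a rainbow copy of $G$ or a monochromatic copy of $H$. -}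

module Defs where

open import Level using (0ℓ)
open import Data.Nat.Base using (ℕ; suc; _+_; _*_; _≤_; _<_)
import Data.Nat.Properties as ℕ
open import Data.Nat.Combinatorics using (_C_)
open import Data.Integer.Base as ℤ using (ℤ; +_)
open import Data.Rational.Unnormalised.Base as ℚᵘ using (ℚᵘ; 0ℚᵘ; 1ℚᵘ)
open import Data.Fin.Base using (Fin; toℕ)
open import Data.Fin.Properties using (_≟_)
open import Data.Product.Base using (∃-syntax; _×_; _,_)
open import Data.Sum.Base using (_⊎_; inj₁; inj₂; [_,_])
open import Function.Definitions using (Injective)
open import Relation.Binary.Core using (Rel)
open import Relation.Binary.Definitions using (Symmetric; Decidable)
open import Relation.Binary.Construct.Closure.Symmetric using (SymClosure; fwd; bwd; symmetric)
open import Relation.Binary.PropositionalEquality using (_≡_; _≢_; refl; sym; trans)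
open import Relation.Nullary using (¬_)
open import Relation.Nullary.Decidable using (map′; ¬?; _×-dec_; _⊎-dec_)

record Graph : Set₁ where
  infix 4 _~_ _~?_
  field
    order   : ℕ
    _~_     : Rel (Fin order) 0ℓ
    ~-sym   : Symmetric _~_
    ~-irrefl : ∀ {v} → ¬ (v ~ v)
    _~?_    : Decidable _~_

  Vertex : Set
  Vertex = Fin order

open Graph using (Vertex)

symmetrise : ∀ n (R : Rel (Fin n) 0ℓ) → (∀ {v} → ¬ R v v) → Decidable R → Graph
symmetrise n R irrefl R? = record
  { order    = n
  ; _~_      = SymClosure R
  ; ~-sym    = symmetric R
  ; ~-irrefl = λ { (fwd r) → irrefl r ; (bwd r) → irrefl r }
  ; _~?_     = λ u v → map′ [ fwd , bwd ] (λ { (fwd r) → inj₁ r ; (bwd r) → inj₂ r })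
                            (R? u v ⊎-dec R? v u)
  }

K : ℕ → Graph
K n = record
  { order    = n
  ; _~_      = _≢_
  ; ~-sym    = λ u≢v v≡u → u≢v (sym v≡u)
  ; ~-irrefl = λ v≢v → v≢v refl
  ; _~?_     = λ u v → ¬? (u ≟ v)
  }

-- The path with n vertices (and n ∸ 1 edges).
P : ℕ → Graph
P n = symmetrise n (λ u v → toℕ v ≡ suc (toℕ u))
  (λ eq → ℕ.1+n≢n (sym eq))
  (λ u v → toℕ v ℕ.≟ suc (toℕ u))

Spoke : ∀ {t} → Rel (Fin t) 0ℓ
Spoke u v = toℕ u ≡ 0 × toℕ v ≢ 0

LeafEdge : ∀ {t} → ℕ → Rel (Fin t) 0ℓ
LeafEdge r u v = ∃[ s ] (s < r × toℕ u ≡ 1 + 2 * s × toℕ v ≡ 2 + 2 * s)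

-- The star K_{1,t-1} with centre 0, together with the r pairwise independent
-- edges {1,2}, {3,4}, …, {2r-1,2r} between leaves.  Meaningful for 2r < t.
S : ℕ → ℕ → Graph
S t r = symmetrise t (λ u v → Spoke u v ⊎ LeafEdge r u v)
  (λ { (inj₁ (v≡0 , v≢0))          → v≢0 v≡0
     ; (inj₂ (_ , _ , v≡a , v≡1+a)) → ℕ.1+n≢n (trans (sym v≡1+a) v≡a) })
  (λ u v → (toℕ u ℕ.≟ 0 ×-dec ¬? (toℕ v ℕ.≟ 0))
           ⊎-dec ℕ.anyUpTo? (λ s → toℕ u ℕ.≟ 1 + 2 * s ×-dec toℕ v ℕ.≟ 2 + 2 * s) r)

-- Only the values of colour at adjacent pairs carry meaning: every notion
-- below consults colour on edges alone.
record EdgeColouring (G : Graph) (k : ℕ) : Set where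
  open Graph G using (_~_)
  field
    colour     : Vertex G → Vertex G → Fin k
    colour-sym : ∀ {u v} → u ~ v → colour u v ≡ colour v u

Exact : ∀ {G k} → EdgeColouring G k → Set
Exact {G} c = ∀ q → ∃[ u ] ∃[ v ] (u ~ v × colour u v ≡ q)
  where open Graph G using (_~_)
        open EdgeColouring c

-- A not necessarily induced subgraph of G isomorphic to H.
record Copy (H G : Graph) : Set where
  private
    module H = Graph H
    module G = Graph G
  field
    embed      : Vertex H → Vertex G
    injective  : Injective _≡_ _≡_ embed
    preserves  : ∀ {u v} → u H.~ v → embed u G.~ embed v

SameEdge : ∀ {n} → (u v x y : Fin n) → Set
SameEdge u v x y = (u ≡ x × v ≡ y) ⊎ (u ≡ y × v ≡ x)

Rainbow : ∀ {H G k} → EdgeColouring G k → Copy H G → Set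
Rainbow {H} c f = ∀ {u v x y} → u ~ v → x ~ y →
    colour (embed u) (embed v) ≡ colour (embed x) (embed y) → SameEdge u v x y
  where open Graph H using (_~_)
        open EdgeColouring c
        open Copy f

Monochromatic : ∀ {H G k} → EdgeColouring G k → Copy H G → Set
Monochromatic {H} c f = ∃[ q ] (∀ {u v} → u ~ v → colour (embed u) (embed v) ≡ q)
  where open Graph H using (_~_)
        open EdgeColouring c
        open Copy f

GallaiRamseyBound : ℕ → Graph → Graph → ℕ → Set
GallaiRamseyBound k G H N =
  k ≤ N C 2 ×
  (∀ n → N ≤ n → (c : EdgeColouring (K n) k) → Exact c →
     (∃[ f ] Rainbow {G} c f) ⊎ (∃[ f ] Monochromatic {H} c f))

-- gr k G H ≔ N is the relation "gr_k(G : H) = N".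
infix 4 gr_⦅_∶_⦆≔_
gr_⦅_∶_⦆≔_ : ℕ → Graph → Graph → ℕ → Set
gr k ⦅ G ∶ H ⦆≔ N =
  GallaiRamseyBound k G H N × (∀ M → GallaiRamseyBound k G H M → N ≤ M)

-- A real number x is represented by its closed upper Dedekind cut, the set of
-- rationals q with x ≤ q.
UpperReal : Set₁
UpperReal = ℚᵘ → Set

-- √a ≤ q  iff  0 ≤ q and a ≤ q².
√_ : ℕ → UpperReal
(√ a) q = 0ℚᵘ ℚᵘ.≤ q × (+ a ℚᵘ./ 1) ℚᵘ.≤ q ℚᵘ.* q

-- 1 + x ≤ q  iff  x ≤ q - 1.
1+ᴿ_ : UpperReal → UpperReal
(1+ᴿ x) q = x (q ℚᵘ.- 1ℚᵘ)

-- x / 2 ≤ q  iff  x ≤ q + q.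
_/2 : UpperReal → UpperReal
(x /2) q = x (q ℚᵘ.+ q)

infix  9 √_
infixr 7 1+ᴿ_
infixl 8 _/2
infix  4 ⌈_⌉≔_

-- ⌈ x ⌉≔ m says that m is the least integer with x ≤ m.
⌈_⌉≔_ : UpperReal → ℤ → Set
⌈ x ⌉≔ m = x (m ℚᵘ./ 1) × (∀ m′ → x (m′ ℚᵘ./ 1) → m ℤ.≤ m′)

{-# OPTIONS --safe #-}

-- With three colours a rainbow P₅ cannot occur, so the number is the Ramsey
-- number of S₆¹: its lower bound is a 2-coloured pentagon blown up by
-- monochromatic K₅'s, and its upper bound holds because a vertex with five
-- edges of one colour lies in no triangle of that colour (unless S₆¹ occurs).
-- Hence a large colour class around a vertex loses that colour, which bounds
-- every class from above, therefore also from below by five, and then any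
-- monochromatic triangle yields S₆¹.
--
-- With at least four colours, any seven vertices spanning four colours contain a
-- rainbow P₅ or S₆¹; with at least seven colours and five or six vertices, a
-- rainbow P₅ or S₆¹ is again unavoidable.  Both are finite searches over partial
-- colourings of a growing set of named vertices: either an edge between named
-- vertices is coloured, or an edge of a colour not yet seen is named.  So the
-- number of vertices visited does not depend on n.

module Submission where

open import Defs
open import Data.Nat.Base
open import Data.Integer.Base as ℤ using (+_; -[1+_])
open import Data.Product.Base using (_×_; _,_; proj₁; proj₂; ∃; ∃-syntax)
open import Relation.Binary.PropositionalEquality
  using (_≡_; _≢_; refl; sym; trans; cong; cong₂; subst; subst₂; module ≡-Reasoning)

open import Data.Bool.Base using (Bool; true; false; if_then_else_; not; _∧_; _∨_; T)
open import Data.Bool.ListAction using (all; any)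
open import Data.Bool.Properties using (T?; T-∧; T-∨; T-≡; T-not-≡)
open import Data.Empty using (⊥)
open import Data.Fin.Base as Fin
  using (Fin; zero; suc; toℕ; fromℕ<; inject₁; inject≤; quotient; remainder; combine
        ; punchOut)
open import Data.Fin.Patterns using (0F; 1F; 2F; 3F)
import Data.Fin.Properties as Fin
import Data.Integer.Properties as ℤ
open import Data.List.Base as List
  using (List; []; _∷_; _++_; map; concatMap; null; upTo; downFrom; filter; filterᵇ
        ; cartesianProduct; deduplicateᵇ; length; applyUpTo; allFin)
open import Data.List.Membership.Propositional using (_∈_; find)
open import Data.List.Membership.Propositional.Properties
  using (∈-lookup; ∈-upTo⁺; ∈-downFrom⁺; ∈-downFrom⁻; ∈-filter⁺; ∈-filter⁻
        ; ∈-cartesianProduct⁺; ∈-cartesianProduct⁻; ∈-applyUpTo⁻; ∈-++⁻; ∈-∃++; ∈-allFin)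
open import Data.List.Properties using (filter-notAll; length-tabulate)
open import Data.List.Relation.Binary.Permutation.Propositional using (_↭_; ↭-trans; ↭-prep)
open import Data.List.Relation.Binary.Permutation.Propositional.Properties
  using (shift; ↭-length; ∈-resp-↭; All-resp-↭)
open import Data.List.Relation.Binary.Sublist.Propositional.Properties
  using (filter-⊆; length-mono-≤)
  renaming (filter⁺ to ⊆-filter⁺)
open import Data.List.Relation.Unary.All as All using (All; []; _∷_)
import Data.List.Relation.Unary.All.Properties as All
open import Data.List.Relation.Unary.AllPairs as AllPairs using (AllPairs; []; _∷_)
import Data.List.Relation.Unary.AllPairs.Properties as AllPairs
open import Data.List.Relation.Unary.Any as Any using (here; there; satisfied)
import Data.List.Relation.Unary.Any.Properties as Any
open import Data.List.Relation.Unary.Unique.Propositional using (Unique)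
import Data.List.Relation.Unary.Unique.Propositional.Properties as Unique
open import Data.Nat.Combinatorics using (_C_; nC1≡n; nCk+nC[k+1]≡[n+1]C[k+1])
open import Data.Nat.DivMod using (_%_)
open import Data.Nat.Properties
open import Data.Nat.Tactic.RingSolver using (solve-∀)
open import Data.Product.Properties using (≡-dec)
open import Data.List.Membership.DecPropositional (≡-dec _≟_ (≡-dec _≟_ _≟_)) using (_∈?_)
open import Data.Rational.Unnormalised.Base as ℚᵘ using (mkℚᵘ; *≤*)
open import Data.Sum.Base using (_⊎_; inj₁; inj₂; [_,_]′)
open import Data.Vec.Base as Vec using (Vec; []; _∷_; lookup; toList)
open import Data.Vec.Properties using (lookup-map)
import Data.Vec.Relation.Unary.AllPairs as VecAllPairs
open import Data.Vec.Relation.Unary.Unique.Propositional using () renaming (Unique to VecUnique)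
open import Data.Vec.Relation.Unary.Unique.Propositional.Properties using (lookup-injective)
open import Function.Base using (_∘_)
open import Function.Bundles using (Equivalence)
open import Function.Definitions using (Injective)
open import Relation.Binary.Construct.Closure.Symmetric using (fwd; bwd)
open import Relation.Binary.Definitions using (Symmetric; tri<; tri≈; tri>)
open import Relation.Nullary using (¬_; Dec; yes; no; contradiction)
open import Relation.Nullary.Decidable
  using (does; from-yes; decidable-stable; ¬?; _×-dec_; _→-dec_)
open import Relation.Unary using (Decidable)

open Equivalence using (to; from)

-- Partial colourings and candidates for the forbidden subgraphs.

Entry : Set
Entry = ℕ × ℕ × ℕ

-- A partial colouring: the numbers below `order` and below `colours` name distinct vertices and
-- distinct colours. Every coloured edge is listed in both orientations, the newest first.
record State : Set where
  constructor ⟨_,_,_⟩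
  field
    order colours : ℕ
    edges         : List Entry

open State

join : ℕ → ℕ → ℕ → List Entry → List Entry
join u v q es = (u , v , q) ∷ (v , u , q) ∷ es

elem : ∀ {n} → ℕ → Vec ℕ n → Bool
elem x xs = any (x ≡ᵇ_) (toList xs)

incident : ℕ → List Entry → List (ℕ × ℕ)
incident v []                 = []
incident v ((u , w , q) ∷ es) = if u ≡ᵇ v then (w , q) ∷ incident v es else incident v es

unknown : State → List (ℕ × ℕ)
unknown ⟨ m , _ , es ⟩ =
  filter (λ (u , v) → T? ((u <ᵇ v) ∧ not (any (λ (w , _) → v ≡ᵇ w) (incident u es))))
         (cartesianProduct (downFrom m) (downFrom m))

Path : ℕ → Set
Path n = Vec ℕ (suc n) × Vec ℕ n

grow : ∀ {n} → List Entry → Path n → List (Path (suc n))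
grow es (v ∷ vs , qs) =
  map (λ (w , q) → w ∷ v ∷ vs , q ∷ qs)
      (filterᵇ (λ (w , q) → not (elem q qs ∨ elem w (v ∷ vs))) (incident v es))

-- `grow` extends at the head only; reversing the path opens its other end.
growBoth : ∀ {n} → List Entry → Path n → List (Path (suc n))
growBoth es (vs , qs) = grow es (vs , qs) ++ grow es (Vec.reverse vs , Vec.reverse qs)

-- Only paths through the most recently added edge are proposed.  Proposals, here
-- and below, carry no proof: found and starFound check them afterwards.
pathCandidates : List Entry → List (Path 4)
pathCandidates [] = []
pathCandidates es@((u , v , q) ∷ _) =
  concatMap (growBoth es) (concatMap (growBoth es) (growBoth es (u ∷ v ∷ [] , q ∷ [])))

Distinct : ∀ {n} → State → Vec ℕ n → Set
Distinct s vs = VecUnique vs × (∀ i → lookup vs i < order s)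

unique? : ∀ {n} (xs : Vec ℕ n) → Dec (VecUnique xs)
unique? = VecAllPairs.allPairs? (λ x y → ¬? (x ≟ y))

distinct? : ∀ {n} s (vs : Vec ℕ n) → Dec (Distinct s vs)
distinct? s vs = unique? vs ×-dec Fin.all? (λ i → _ <? order s)

RainbowPath : State → Path 4 → Set
RainbowPath s (vs , qs) = Distinct s vs × VecUnique qs ×
  (∀ i → (lookup vs (inject₁ i) , lookup vs (suc i) , lookup qs i) ∈ edges s)

rainbowPath? : ∀ s π → Dec (RainbowPath s π)
rainbowPath? s (vs , qs) = distinct? s vs ×-dec unique? qs ×-dec Fin.all? (λ i → _ ∈? edges s)

-- Not itself a target: such a star ends one search because the next one starts from it.
RainbowStar : ∀ {d} → State → ℕ → Vec (ℕ × ℕ) d → Set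
RainbowStar s x ls = Distinct s (x ∷ Vec.map proj₁ ls) × VecUnique (Vec.map proj₂ ls) ×
  (∀ i → (x , lookup ls i) ∈ edges s)

rainbowStar? : ∀ {d} s x (ls : Vec (ℕ × ℕ) d) → Dec (RainbowStar s x ls)
rainbowStar? s x ls = distinct? s _ ×-dec unique? _ ×-dec Fin.all? (λ i → _ ∈? edges s)

prefixes : ∀ {A : Set} d → List A → List (Vec A d)
prefixes zero    _        = [] ∷ []
prefixes (suc d) []       = []
prefixes (suc d) (x ∷ xs) = map (x ∷_) (prefixes d xs)

-- Deduplication keeps one leaf for each colour at the centre. Only the ends of the newest edge are
-- tried as centres, since only they can have gained a colour.
starCandidates : ∀ d → List Entry → List (ℕ × Vec (ℕ × ℕ) d)
starCandidates d [] = []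
starCandidates d es@((u , v , _) ∷ _) = concatMap around (u ∷ v ∷ [])
  where around : ℕ → List (ℕ × Vec (ℕ × ℕ) d)
        around x = map (x ,_) (prefixes d (deduplicateᵇ (λ (_ , q) (_ , r) → q ≡ᵇ r) (incident x es)))

MonoStar : State → ℕ × ℕ × Vec ℕ 5 → Set
MonoStar s (q , x , ls@(a ∷ b ∷ _)) = Distinct s (x ∷ ls) × (a , b , q) ∈ edges s ×
  (∀ i → (x , lookup ls i , q) ∈ edges s)

monoStar? : ∀ s σ → Dec (MonoStar s σ)
monoStar? s (q , x , ls@(a ∷ b ∷ _)) =
  distinct? s (x ∷ ls) ×-dec (a , b , q) ∈? edges s ×-dec Fin.all? (λ i → _ ∈? edges s)

-- Only the colour of the newest edge can have completed a star; every vertex is tried as centre,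
-- since the newest edge may be the one between leaves.
monoCandidates : State → List (ℕ × ℕ × Vec ℕ 5)
monoCandidates ⟨ m , _ , [] ⟩ = []
monoCandidates ⟨ m , _ , es@((_ , _ , q) ∷ _) ⟩ = if 5 <ᵇ m then concatMap around (downFrom m) else []
  where
  around : ℕ → List (ℕ × ℕ × Vec ℕ 5)
  around x = if 4 <ᵇ length ls then concatMap inner es else []
    where
    ls = map proj₁ (filterᵇ (λ (_ , r) → q ≡ᵇ r) (incident x es))
    inner : Entry → List (ℕ × ℕ × Vec ℕ 5)
    inner (a , b , r) =
      if (q ≡ᵇ r) ∧ any (a ≡ᵇ_) ls ∧ any (b ≡ᵇ_) ls
      then map (λ vs → q , x , vs) (prefixes 5 (a ∷ b ∷ filterᵇ (λ w → not ((a ≡ᵇ w) ∨ (b ≡ᵇ w))) ls))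
      else []

found : State → Bool
found s = any (λ π → does (rainbowPath? s π)) (pathCandidates (edges s))
        ∨ any (λ σ → does (monoStar? s σ)) (monoCandidates s)

starFound : ℕ → State → Bool
starFound d s = any (λ (x , ls) → does (rainbowStar? s x ls)) (starCandidates d (edges s))

starState : ℕ → State
starState d = ⟨ suc d , d , applyUpTo (λ i → 0 , suc i , i) d ++ applyUpTo (λ i → suc i , 0 , i) d ⟩

-- The search assumes at least lo vertices and at least κ colours.  While fewer
-- than eager colours have been named, a new colour is sought before the known
-- vertices are completed; this only affects the size of the search tree.
module Searching (lo κ eager : ℕ) (closed : State → Bool) where

  search : ℕ → State → Bool
  -- Running out of fuel counts as failure, so the fuel does not affect soundness.
  search zero    _ = false
  search (suc t) s@(⟨ m , p , es ⟩) = closed s ∨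
    (if (p <ᵇ κ) ∧ ((p <ᵇ eager) ∨ null (unknown s))
     -- An edge of an unseen colour has two, one or no named ends; if two, the pair is still
     -- uncoloured.
     then all (λ (u , v) → search t ⟨ m , suc p , join u v p es ⟩) (unknown s)
        ∧ all (λ u → search t ⟨ suc m , suc p , join u m p es ⟩) (upTo m)
        ∧ search t ⟨ 2 + m , suc p , join m (suc m) p es ⟩
     else split (unknown s))
    where
    split : List (ℕ × ℕ) → Bool
    -- All named pairs are coloured; a further vertex is guaranteed only while fewer than `lo` are
    -- named.
    split []            = (m <ᵇ lo) ∧ search t ⟨ suc m , p , es ⟩
    split ((u , v) ∷ _) = all (λ q → search t ⟨ m , p , join u v q es ⟩) (upTo p)
                        ∧ search t ⟨ m , suc p , join u v p es ⟩

-- Naming maps and the correctness of the list operations.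

override : ∀ {A : Set} → (ℕ → A) → ℕ → A → ℕ → A
override f m x i with i ≟ m
... | yes _ = x
... | no  _ = f i

override-new : ∀ {A : Set} (f : ℕ → A) m {x} → override f m x m ≡ x
override-new f m with m ≟ m
... | yes _   = refl
... | no m≢m = contradiction refl m≢m

override-old : ∀ {A : Set} (f : ℕ → A) {m x i} → i < m → override f m x i ≡ f i
override-old f {m} {i = i} i<m with i ≟ m
... | yes i≡m = contradiction i≡m (<⇒≢ i<m)
... | no  _   = refl

InjectiveBelow : ∀ {A : Set} → ℕ → (ℕ → A) → Set
InjectiveBelow m f = ∀ {i j} → i < m → j < m → f i ≡ f j → i ≡ j

override-injective : ∀ {A : Set} {f : ℕ → A} {m x} → InjectiveBelow m f →
                     (∀ {i} → i < m → f i ≢ x) → InjectiveBelow (suc m) (override f m x)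
override-injective {f = f} {m} inj fresh {i} {j} i≤m j≤m eq with i ≟ m | j ≟ m
... | yes i≡m | yes j≡m = trans i≡m (sym j≡m)
... | yes _   | no j≢m  = contradiction (sym eq) (fresh (≤∧≢⇒< (s≤s⁻¹ j≤m) j≢m))
... | no i≢m  | yes _   = contradiction eq (fresh (≤∧≢⇒< (s≤s⁻¹ i≤m) i≢m))
... | no i≢m  | no j≢m  = inj (≤∧≢⇒< (s≤s⁻¹ i≤m) i≢m) (≤∧≢⇒< (s≤s⁻¹ j≤m) j≢m) eq

named? : ∀ {N} (f : ℕ → Fin N) m x → (∃[ i ] (i < m × f i ≡ x)) ⊎ (∀ {i} → i < m → f i ≢ x)
named? f m x with anyUpTo? (λ i → f i Fin.≟ x) m
... | yes p = inj₁ p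
... | no ¬p = inj₂ (λ i<m eq → ¬p (_ , i<m , eq))

-- If every element had a name, choosing one for each would inject `Fin N` into `Fin m`.
unnamed : ∀ {N} (f : ℕ → Fin N) {m} → m < N → ∃[ x ] (∀ {i} → i < m → f i ≢ x)
unnamed {N} f {m} m<N with Fin.any? (λ x → ¬? (anyUpTo? (λ i → f i Fin.≟ x) m))
... | yes (x , ¬p) = x , λ i<m eq → ¬p (_ , i<m , eq)
... | no ¬∃ = contradiction (Fin.injective⇒≤ {f = back} back-injective) (<⇒≱ m<N)
  where
  preimage : ∀ x → ∃[ i ] (i < m × f i ≡ x)
  preimage x = decidable-stable (anyUpTo? (λ i → f i Fin.≟ x) m) (λ ¬p → ¬∃ (x , ¬p))
  back : Fin N → Fin m
  back x = fromℕ< (proj₁ (proj₂ (preimage x)))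
  back-injective : Injective _≡_ _≡_ back
  back-injective {x} {y} eq = begin
    x                       ≡⟨ proj₂ (proj₂ (preimage x)) ⟨
    f (proj₁ (preimage x))  ≡⟨ cong f (Fin.fromℕ<-injective _ _ _ _ eq) ⟩
    f (proj₁ (preimage y))  ≡⟨ proj₂ (proj₂ (preimage y)) ⟩
    y                       ∎
    where open ≡-Reasoning

any-sound : ∀ {A : Set} {P : A → Set} (P? : ∀ x → Dec (P x)) xs → T (any (does ∘ P?) xs) → ∃ P
any-sound P? xs t with satisfied (Any.any⁻ (does ∘ P?) xs t)
... | x , Px with P? x
...   | yes p = x , p

-- Total, because naming maps are functions on all of ℕ; the default 0 lies outside the range that
-- is consulted.
at : ∀ {d} → Vec ℕ d → ℕ → ℕ
at []       _       = 0
at (x ∷ xs) zero    = x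
at (x ∷ xs) (suc i) = at xs i

at-toℕ : ∀ {d} (xs : Vec ℕ d) i → at xs (toℕ i) ≡ lookup xs i
at-toℕ (x ∷ xs) zero    = refl
at-toℕ (x ∷ xs) (suc i) = at-toℕ xs i

∀Fin⇒∀< : ∀ {d} {P : ℕ → Set} → (∀ (i : Fin d) → P (toℕ i)) → ∀ {i} → i < d → P i
∀Fin⇒∀< {P = P} p i<d = subst P (Fin.toℕ-fromℕ< i<d) (p (fromℕ< i<d))

at-injective : ∀ {A : Set} {d} (f : ℕ → A) (xs : Vec ℕ d) →
               Injective _≡_ _≡_ (λ i → f (lookup xs i)) → InjectiveBelow d (f ∘ at xs)
at-injective {d = d} f xs inj {i} {j} i<d j<d = ∀Fin⇒∀< {P = λ i → f (at xs i) ≡ f (at xs j) → i ≡ j}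
  (λ i → ∀Fin⇒∀< {P = λ j → f (at xs (toℕ i)) ≡ f (at xs j) → toℕ i ≡ j}
    (λ j eq → cong toℕ (inj (trans (cong f (sym (at-toℕ xs i))) (trans eq (cong f (at-toℕ xs j)))))) j<d) i<d

incident-∈ : ∀ u es {v q} → (v , q) ∈ incident u es → (u , v , q) ∈ es
incident-∈ u ((w , _ , _) ∷ es) e with w ≡ᵇ u in eq
incident-∈ u ((w , _ , _) ∷ es) (here refl) | true rewrite ≡ᵇ⇒≡ w u (from T-≡ eq) = here refl
incident-∈ u (_ ∷ es) (there e) | true  = there (incident-∈ u es e)
incident-∈ u (_ ∷ es) e         | false = there (incident-∈ u es e)

unknown-sound : ∀ s {u v} → (u , v) ∈ unknown s → u < order s × v < order s × u ≢ v
unknown-sound ⟨ m , _ , es ⟩ e =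
  let e′ , p = ∈-filter⁻ _ {xs = cartesianProduct (downFrom m) (downFrom m)} e
      u∈ , v∈ = ∈-cartesianProduct⁻ (downFrom m) (downFrom m) e′
  in ∈-downFrom⁻ u∈ , ∈-downFrom⁻ v∈ , <⇒≢ (<ᵇ⇒< _ _ (proj₁ (to T-∧ p)))

unknown-complete : ∀ s {u v} → u < v → v < order s →
                   (∃[ q ] (u , v , q) ∈ edges s) ⊎ (u , v) ∈ unknown s
unknown-complete ⟨ m , _ , es ⟩ {u} {v} u<v v<m with any (λ (w , _) → v ≡ᵇ w) (incident u es) in eq
... | true =
  let (w , q) , w∈ , v≡w = find (Any.any⁻ (λ (w , _) → v ≡ᵇ w) (incident u es) (from T-≡ eq))
  in inj₁ (q , incident-∈ u es (subst (λ w → (w , q) ∈ incident u es) (sym (≡ᵇ⇒≡ v w v≡w)) w∈))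
... | false = inj₂ (∈-filter⁺ _ (∈-cartesianProduct⁺ (∈-downFrom⁺ (<-trans u<v v<m)) (∈-downFrom⁺ v<m))
  (from T-∧ (<⇒<ᵇ u<v , from T-not-≡ eq)))

-- Soundness of the search in an actual colouring.

module Colouring {n k : ℕ} (c : EdgeColouring (K n) k) where

  open EdgeColouring c

  Unavoidable : Set
  Unavoidable = (∃[ f ] Rainbow {P 5} c f) ⊎ (∃[ f ] Monochromatic {S 6 1} c f)

  -- Each edge of the path, in either orientation, is the step at one index `i`; equal colours force
  -- equal indices, hence the same edge.
  rainbow-path : (f : Fin 5 → Fin n) → Injective _≡_ _≡_ f →
                 (γ : Fin 4 → Fin k) → Injective _≡_ _≡_ γ →
                 (∀ i → colour (f (inject₁ i)) (f (suc i)) ≡ γ i) → Unavoidable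
  rainbow-path f f-inj γ γ-inj col = inj₁ (copy , rainbow)
    where
    module P₅ = Graph (P 5)
    adjacent-≢ : ∀ {u v} → u P₅.~ v → u ≢ v
    adjacent-≢ u~v refl = P₅.~-irrefl u~v
    edge : ∀ {u v : Fin 5} → toℕ v ≡ suc (toℕ u) → ∃[ i ] (inject₁ i ≡ u × suc i ≡ v)
    edge {u} {suc i} eq = i , Fin.toℕ-injective (trans (Fin.toℕ-inject₁ i) (suc-injective eq)) , refl
    colour-edge : ∀ {u v} → u P₅.~ v → ∃[ i ] (colour (f u) (f v) ≡ γ i × SameEdge u v (inject₁ i) (suc i))
    colour-edge (fwd eq) with edge eq
    ... | i , refl , refl = i , col i , inj₁ (refl , refl)
    colour-edge u~v@(bwd eq) with edge eq
    ... | i , refl , refl = i , trans (colour-sym (adjacent-≢ u~v ∘ f-inj)) (col i) , inj₂ (refl , refl)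
    copy : Copy (P 5) (K n)
    copy = record { embed = f ; injective = f-inj ; preserves = λ u~v eq → adjacent-≢ u~v (f-inj eq) }
    rainbow : Rainbow c copy
    rainbow u~v x~y eq with colour-edge u~v | colour-edge x~y
    ... | i , uv≡i , uv | j , xy≡j , xy with γ-inj (trans (sym uv≡i) (trans eq xy≡j))
    rainbow u~v x~y eq | i , _ , inj₁ (refl , refl) | j , _ , inj₁ (refl , refl) | refl = inj₁ (refl , refl)
    rainbow u~v x~y eq | i , _ , inj₁ (refl , refl) | j , _ , inj₂ (refl , refl) | refl = inj₂ (refl , refl)
    rainbow u~v x~y eq | i , _ , inj₂ (refl , refl) | j , _ , inj₁ (refl , refl) | refl = inj₂ (refl , refl)
    rainbow u~v x~y eq | i , _ , inj₂ (refl , refl) | j , _ , inj₂ (refl , refl) | refl = inj₁ (refl , refl)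

  mono-star : (f : Fin 6 → Fin n) → Injective _≡_ _≡_ f → ∀ q →
              (∀ i → colour (f zero) (f (suc i)) ≡ q) →
              colour (f (suc zero)) (f (suc (suc zero))) ≡ q → Unavoidable
  mono-star f f-inj q spoke leaf = inj₂ (record
    { embed = f ; injective = f-inj ; preserves = λ u~v eq → adjacent-≢ u~v (f-inj eq) } , q , mono)
    where
    module S₆ = Graph (S 6 1)
    adjacent-≢ : ∀ {u v} → u S₆.~ v → u ≢ v
    adjacent-≢ u~v refl = S₆.~-irrefl u~v
    oriented : ∀ {u v : Fin 6} → Spoke u v ⊎ LeafEdge 1 u v → colour (f u) (f v) ≡ q
    oriented {zero} {zero}  (inj₁ (_ , v≢0)) = contradiction refl v≢0
    oriented {zero} {suc i} (inj₁ _) = spoke i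
    oriented (inj₂ (zero , _ , u≡1 , v≡2))
      rewrite Fin.toℕ-injective {j = suc {n = 5} zero} u≡1
            | Fin.toℕ-injective {j = suc {n = 5} (suc zero)} v≡2 = leaf
    oriented (inj₂ (suc _ , s≤s () , _))
    mono : ∀ {u v} → u S₆.~ v → colour (f u) (f v) ≡ q
    mono (fwd r)       = oriented r
    mono u~v@(bwd r) = trans (colour-sym (adjacent-≢ u~v ∘ f-inj)) (oriented r)

  -- A realisation of the state inside `c`. The bounds stored in `edge` keep recorded edges valid
  -- when a further name is assigned by `override`.
  record Model (s : State) : Set where
    constructor model
    field
      vertex           : ℕ → Fin n
      paint            : ℕ → Fin k
      vertex-injective : InjectiveBelow (order s) vertex
      paint-injective  : InjectiveBelow (colours s) paint
      edge             : ∀ {u v q} → (u , v , q) ∈ edges s →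
                         u < order s × v < order s × q < colours s × colour (vertex u) (vertex v) ≡ paint q

  open Model

  addVertex : ∀ {m p es} (M : Model ⟨ m , p , es ⟩) {x} → (∀ {i} → i < m → vertex M i ≢ x) →
              Model ⟨ suc m , p , es ⟩
  addVertex {m} M {x} fresh = model (override (vertex M) m x) (paint M)
    (override-injective (vertex-injective M) fresh) (paint-injective M)
    λ e → let u<m , v<m , q<p , eq = edge M e in
          m<n⇒m<1+n u<m , m<n⇒m<1+n v<m , q<p ,
          trans (cong₂ colour (override-old (vertex M) u<m) (override-old (vertex M) v<m)) eq

  addColour : ∀ {m p es} (M : Model ⟨ m , p , es ⟩) {x} → (∀ {q} → q < p → paint M q ≢ x) →
              Model ⟨ m , suc p , es ⟩
  addColour {p = p} M {x} fresh = model (vertex M) (override (paint M) p x)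
    (vertex-injective M) (override-injective (paint-injective M) fresh)
    λ e → let u<m , v<m , q<p , eq = edge M e in
          u<m , v<m , m<n⇒m<1+n q<p , trans eq (sym (override-old (paint M) q<p))

  addEdge : ∀ {m p es} (M : Model ⟨ m , p , es ⟩) {u v q} → u < m → v < m → q < p → u ≢ v →
            colour (vertex M u) (vertex M v) ≡ paint M q → Model ⟨ m , p , join u v q es ⟩
  addEdge M u<m v<m q<p u≢v eq = model (vertex M) (paint M) (vertex-injective M) (paint-injective M)
    λ { (here refl)         → u<m , v<m , q<p , eq
      ; (there (here refl)) → v<m , u<m , q<p ,
          trans (colour-sym λ eq′ → u≢v (sym (vertex-injective M v<m u<m eq′))) eq
      ; (there (there e))   → edge M e }

  addColouredEdge : ∀ {m p es} (M : Model ⟨ m , p , es ⟩) {u v} → u < m → v < m → u ≢ v →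
                    (∀ {q} → q < p → paint M q ≢ colour (vertex M u) (vertex M v)) →
                    Model ⟨ m , suc p , join u v p es ⟩
  addColouredEdge {p = p} M u<m v<m u≢v fresh =
    addEdge (addColour M fresh) u<m v<m ≤-refl u≢v (sym (override-new (paint M) p))

  distinct-vertices : ∀ {s d} (M : Model s) {vs : Vec ℕ d} → Distinct s vs →
                      Injective _≡_ _≡_ (λ i → vertex M (lookup vs i))
  distinct-vertices M (vs! , vs<) {i} {j} eq =
    lookup-injective vs! i j (vertex-injective M (vs< i) (vs< j) eq)

  model-path : ∀ {s} → Model s → ∀ π → RainbowPath s π → Unavoidable
  model-path M (vs , qs) (d , qs! , es) =
    rainbow-path (λ i → vertex M (lookup vs i))
      (distinct-vertices M {vs = vs} d)
      (λ i → paint M (lookup qs i))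
      (λ {i} {j} eq → lookup-injective qs! i j
        (paint-injective M (q< i) (q< j) eq))
      (λ i → proj₂ (proj₂ (proj₂ (edge M (es i)))))
    where q< = λ i → proj₁ (proj₂ (proj₂ (edge M (es i))))

  model-star : ∀ {s} → Model s → ∀ σ → MonoStar s σ → Unavoidable
  model-star {s} M (q , x , ls@(_ ∷ _ ∷ _)) (d , ab , es) =
    mono-star (λ i → vertex M (lookup (x ∷ ls) i))
      (distinct-vertices M {vs = x ∷ ls} d)
      (paint M q) (λ i → colour≡ (es i)) (colour≡ ab)
    where
    colour≡ : ∀ {u v} → (u , v , q) ∈ edges s → colour (vertex M u) (vertex M v) ≡ paint M q
    colour≡ e = proj₂ (proj₂ (proj₂ (edge M e)))

  found-sound : ∀ s → T (found s) → Model s → Unavoidable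
  found-sound s found M with to T-∨ found
  ... | inj₁ t = let π , p = any-sound (rainbowPath? s) (pathCandidates (edges s)) t in model-path M π p
  ... | inj₂ t = let σ , p = any-sound (monoStar? s) (monoCandidates s) t in model-star M σ p

  -- Renames along the star and forgets all other edges, so that the next search has one fixed
  -- starting state however the star was found.
  starModel : ∀ {s d} → Model s → ∀ x (ls : Vec (ℕ × ℕ) d) → RainbowStar s x ls → Model (starState d)
  starModel {s} {d} M x ls (vs! , qs! , es) = model (f ∘ at (x ∷ vs)) (g ∘ at qs)
    (at-injective f (x ∷ vs) (distinct-vertices M vs!))
    (at-injective g qs λ {i} {j} eq → lookup-injective qs! i j
      (paint-injective M (q< i) (q< j) eq))
    edge′
    where
    f = vertex M
    g = paint M
    vs = Vec.map proj₁ ls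
    qs = Vec.map proj₂ ls
    q< : ∀ i → lookup qs i < colours s
    q< i rewrite lookup-map i proj₂ ls = proj₁ (proj₂ (proj₂ (edge M (es i))))
    centre≢ : ∀ i → f x ≢ f (lookup vs i)
    centre≢ i eq with () ← distinct-vertices M vs! {zero} {suc i} eq
    spoke : ∀ i → colour (f x) (f (at vs (toℕ i))) ≡ g (at qs (toℕ i)) ×
                  colour (f (at vs (toℕ i))) (f x) ≡ g (at qs (toℕ i))
    spoke i rewrite at-toℕ vs i | at-toℕ qs i = eq , trans (colour-sym (centre≢ i ∘ sym)) eq
      where
      eq : colour (f x) (f (lookup vs i)) ≡ g (lookup qs i)
      eq rewrite lookup-map i proj₁ ls | lookup-map i proj₂ ls = proj₂ (proj₂ (proj₂ (edge M (es i))))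
    spoke< = ∀Fin⇒∀< {P = λ i → colour (f x) (f (at vs i)) ≡ g (at qs i) ×
                               colour (f (at vs i)) (f x) ≡ g (at qs i)} spoke
    edge′ : ∀ {u v q} → (u , v , q) ∈ edges (starState d) →
            u < suc d × v < suc d × q < d × colour (f (at (x ∷ vs) u)) (f (at (x ∷ vs) v)) ≡ g (at qs q)
    edge′ e with ∈-++⁻ (applyUpTo (λ i → 0 , suc i , i) d) e
    ... | inj₁ e′ with ∈-applyUpTo⁻ _ e′
    ...   | i , i<d , refl = z<s , s≤s i<d , i<d , proj₁ (spoke< i<d)
    edge′ e | inj₂ e′ with ∈-applyUpTo⁻ _ e′
    ...   | i , i<d , refl = s≤s i<d , z<s , i<d , proj₂ (spoke< i<d)

  starFound-sound : ∀ d → (Model (starState d) → Unavoidable) →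
                    ∀ s → T (starFound d s) → Model s → Unavoidable
  starFound-sound d next s t M =
    let (x , ls) , p = any-sound (λ (x , ls) → rainbowStar? s x ls) (starCandidates d (edges s)) t
    in next (starModel M x ls p)

  module SearchSound (exact : Exact c) {lo κ eager : ℕ} {closed : State → Bool}
    (lo≤n : lo ≤ n) (κ≤k : κ ≤ k)
    (closed-sound : ∀ s → T (closed s) → Model s → Unavoidable) where

    open Searching lo κ eager closed

    -- As `p < κ ≤ k`, some colour has no name yet, and exactness puts it on an edge. The three
    -- continuations treat the cases where two, one or none of the ends of that edge are named.
    newColour-sound : ∀ {m p es} → p < κ →
      (∀ {u v} → (u , v) ∈ unknown ⟨ m , p , es ⟩ → Model ⟨ m , suc p , join u v p es ⟩ → Unavoidable) →
      (∀ {u} → u < m → Model ⟨ suc m , suc p , join u m p es ⟩ → Unavoidable) →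
      (Model ⟨ 2 + m , suc p , join m (suc m) p es ⟩ → Unavoidable) →
      Model ⟨ m , p , es ⟩ → Unavoidable
    newColour-sound {m} {p} {es} p<κ old one two M
      with x , x-fresh ← unnamed (paint M) (<-≤-trans p<κ κ≤k)
      with a , b , a≢b , refl ← exact x = ends (named? (vertex M) m a) (named? (vertex M) m b)
      where
      M≢ : ∀ {q} → q < p → paint M q ≢ colour b a
      M≢ q<p eq = x-fresh q<p (trans eq (colour-sym (a≢b ∘ sym)))
      between : ∀ {i j} → i < j → j < m →
                (∀ {q} → q < p → paint M q ≢ colour (vertex M i) (vertex M j)) → Unavoidable
      between i<j j<m fresh with unknown-complete ⟨ m , p , es ⟩ i<j j<m
      -- A recorded edge has a named colour, so it cannot be the edge of the unseen colour.
      ... | inj₁ (q , e) = let _ , _ , q<p , eq = edge M e in contradiction (sym eq) (fresh q<p)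
      ... | inj₂ e = old e (addColouredEdge M (<-trans i<j j<m) j<m (<⇒≢ i<j) fresh)
      hang : ∀ {i} → i < m → ∀ y → (∀ {j} → j < m → vertex M j ≢ y) →
             (∀ {q} → q < p → paint M q ≢ colour (vertex M i) y) → Unavoidable
      hang {i} i<m y y-fresh fresh = one i<m (addColouredEdge (addVertex M y-fresh)
        (m<n⇒m<1+n i<m) ≤-refl (<⇒≢ i<m)
        λ q<p eq → fresh q<p (trans eq
          (cong₂ colour (override-old (vertex M) i<m) (override-new (vertex M) m))))
      ends : _ → _ → Unavoidable
      ends (inj₁ (i , i<m , refl)) (inj₁ (j , j<m , refl)) with <-cmp i j
      ... | tri< i<j _ _ = between i<j j<m x-fresh
      ... | tri≈ _ refl _ = contradiction refl a≢b
      ... | tri> _ _ j<i = between j<i i<m M≢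
      ends (inj₁ (i , i<m , refl)) (inj₂ b-fresh) = hang i<m b b-fresh x-fresh
      ends (inj₂ a-fresh) (inj₁ (j , j<m , refl)) = hang j<m a a-fresh M≢
      ends (inj₂ a-fresh) (inj₂ b-fresh) = two (addColouredEdge M₂ (m<n⇒m<1+n ≤-refl) ≤-refl (<⇒≢ ≤-refl)
        λ q<p eq → x-fresh q<p (trans eq (cong₂ colour
          (trans (override-old (vertex M₁) {suc m} {b} {m} ≤-refl) (override-new (vertex M) m))
          (override-new (vertex M₁) (suc m)))))
        where
        M₁ = addVertex M a-fresh
        b-fresh₁ : ∀ {i} → i < suc m → vertex M₁ i ≢ b
        b-fresh₁ {i} i≤m eq with i ≟ m
        ... | yes _  = a≢b eq
        ... | no i≢m = b-fresh (≤∧≢⇒< (s≤s⁻¹ i≤m) i≢m) eq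
        M₂ = addVertex M₁ b-fresh₁

    split-sound : ∀ {m p es u v} → u < m → v < m → u ≢ v →
      (∀ {q} → q < p → Model ⟨ m , p , join u v q es ⟩ → Unavoidable) →
      (Model ⟨ m , suc p , join u v p es ⟩ → Unavoidable) →
      Model ⟨ m , p , es ⟩ → Unavoidable
    split-sound {p = p} u<m v<m u≢v known fresh M with named? (paint M) p (colour (vertex M _) (vertex M _))
    ... | inj₁ (q , q<p , eq) = known q<p (addEdge M u<m v<m q<p u≢v (sym eq))
    ... | inj₂ new = fresh (addColouredEdge M u<m v<m u≢v new)

    newVertex-sound : ∀ {m p es} → m < lo →
      (Model ⟨ suc m , p , es ⟩ → Unavoidable) → Model ⟨ m , p , es ⟩ → Unavoidable
    newVertex-sound m<lo next M = next (addVertex M (proj₂ (unnamed (vertex M) (<-≤-trans m<lo lo≤n))))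

    search-sound : ∀ t s → T (search t s) → Model s → Unavoidable
    search-sound (suc t) s@(⟨ m , p , es ⟩) ok with to T-∨ ok
    ... | inj₁ c = closed-sound s c
    ... | inj₂ ok′ with (p <ᵇ κ) ∧ ((p <ᵇ eager) ∨ null (unknown s)) in eq
    ...   | true =
      let ok-old , ok″ = to T-∧ ok′
          ok-one , ok-two = to T-∧ ok″
      in newColour-sound (<ᵇ⇒< p κ (proj₁ (to T-∧ (from T-≡ eq))))
           (λ e → search-sound t _ (All.lookup (All.all⁺ _ (unknown s) ok-old) e))
           (λ u<m → search-sound t _ (All.lookup (All.all⁺ _ (upTo m) ok-one) (∈-upTo⁺ u<m)))
           (search-sound t _ ok-two)
    ...   | false with unknown s in eq′
    ...     | [] = let m<lo , ok″ = to T-∧ ok′ in newVertex-sound (<ᵇ⇒< m lo m<lo) (search-sound t _ ok″)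
    ...     | (u , v) ∷ _ =
      let u<m , v<m , u≢v = unknown-sound s (subst ((u , v) ∈_) (sym eq′) (here refl))
          ok-known , ok-fresh = to T-∧ ok′
      in split-sound u<m v<m u≢v
           (λ q<p → search-sound t _ (All.lookup (All.all⁺ _ (upTo p) ok-known) (∈-upTo⁺ q<p)))
           (search-sound t _ ok-fresh)

-- The two finite searches, each in three stages.

record Succeeds (lo κ eager : ℕ) (base : State → Bool) (t : ℕ) : Set where
  open Searching lo κ eager using (search)
  field
    stage₁ : search (λ s → base s ∨ starFound 2 s) t ⟨ 0 , 0 , [] ⟩ ≡ true
    stage₂ : search (λ s → base s ∨ starFound 3 s) t (starState 2) ≡ true
    stage₃ : search base t (starState 3) ≡ true

module _ {n k : ℕ} {c : EdgeColouring (K n) k} (exact : Exact c) where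
  open Colouring c

  -- The stages are chained through rainbow stars: the first reaches one with two leaves, the second
  -- passes from it to one with three, and the third finishes from there. Each stage may also end in
  -- a target directly.
  descent : ∀ {lo κ eager base t} → Succeeds lo κ eager base t → 0 < n → 0 < k → lo ≤ n → κ ≤ k →
            (∀ s → T (base s) → Model s → Unavoidable) → Unavoidable
  descent {lo} {κ} {eager} {base} {t} ok 0<n 0<k lo≤n κ≤k base-sound =
    stage (closing 2 star₂) ⟨ 0 , 0 , [] ⟩ (Succeeds.stage₁ ok)
      -- Nothing is named yet, so the naming maps may be constant; they only need some vertex and
      -- some colour as value.
      (model (λ _ → fromℕ< 0<n) (λ _ → fromℕ< 0<k) (λ ()) (λ ()) (λ ()))
    where
    open Searching lo κ eager using (search)
    stage : ∀ {closed} → (∀ s → T (closed s) → Model s → Unavoidable) →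
            ∀ s → search closed t s ≡ true → Model s → Unavoidable
    stage closed-sound s eq =
      SearchSound.search-sound exact lo≤n κ≤k closed-sound t s (subst T (sym eq) _)
    closing : ∀ d → (Model (starState d) → Unavoidable) →
              ∀ s → T (base s ∨ starFound d s) → Model s → Unavoidable
    closing d next s ok′ = [ base-sound s , starFound-sound d next s ]′ (to T-∨ ok′)
    star₃ : Model (starState 3) → Unavoidable
    star₃ = stage base-sound (starState 3) (Succeeds.stage₃ ok)
    star₂ : Model (starState 2) → Unavoidable
    star₂ = stage (closing 3 star₃) (starState 2) (Succeeds.stage₂ ok)

-- In a colouring on at most `m` vertices a state with more named vertices has no model, so its
-- branch may be closed.
beyond : ℕ → State → Bool
beyond m s = (m <ᵇ order s) ∨ found s

-- Verified by evaluation: at least 7 vertices, at least 4 colours, colours sought first until 3 are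
-- named, and depth bounded by 40.
four-succeeds : Succeeds 7 4 3 found 40
four-succeeds = record { stage₁ = refl ; stage₂ = refl ; stage₃ = refl }

seven-succeeds : Succeeds 5 7 7 (beyond 6) 40
seven-succeeds = record { stage₁ = refl ; stage₂ = refl ; stage₃ = refl }

module _ {n k : ℕ} {c : EdgeColouring (K n) k} (exact : Exact c) where
  open Colouring c

  four-colours : 7 ≤ n → 4 ≤ k → Unavoidable
  four-colours 7≤n 4≤k =
    descent exact four-succeeds (≤-trans z<s 7≤n) (≤-trans z<s 4≤k) 7≤n 4≤k found-sound

  -- From seven vertices on, four colours already suffice. Otherwise `n` is 5 or 6, and a seventh
  -- named vertex would contradict injectivity of the names.
  seven-colours : 5 ≤ n → 7 ≤ k → Unavoidable
  seven-colours 5≤n 7≤k with 7 ≤? n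
  ... | yes 7≤n = four-colours 7≤n (≤-trans (m≤m+n 4 3) 7≤k)
  ... | no  7≰n =
    descent exact seven-succeeds (≤-trans z<s 5≤n) (≤-trans z<s 7≤k) 5≤n 7≤k sound
    where
    sound : ∀ s → T (beyond 6 s) → Model s → Unavoidable
    sound s t M with to T-∨ t
    ... | inj₁ 6<m = contradiction (≤-trans (<ᵇ⇒< 6 _ 6<m) (Fin.injective⇒≤ inj)) 7≰n
      where
      open Model M
      inj : ∀ {i j} → vertex (toℕ {order s} i) ≡ vertex (toℕ j) → i ≡ j
      inj eq = Fin.toℕ-injective (vertex-injective (Fin.toℕ<n _) (Fin.toℕ<n _) eq)
    ... | inj₂ f = found-sound s f M

-- The Ramsey argument for three colours.

extract : ∀ {A : Set} {x : A} {xs} → x ∈ xs → ∃[ ys ] xs ↭ x ∷ ys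
extract x∈xs with ys , zs , refl ← ∈-∃++ x∈xs = ys List.++ zs , shift _ ys zs

AllPairs-resp-↭ : ∀ {A : Set} {R : A → A → Set} → Symmetric R → ∀ {xs ys} → xs ↭ ys → AllPairs R xs → AllPairs R ys
AllPairs-resp-↭ R-sym _↭_.refl rs = rs
AllPairs-resp-↭ R-sym (_↭_.prep x p) (r ∷ rs) = All-resp-↭ p r ∷ AllPairs-resp-↭ R-sym p rs
AllPairs-resp-↭ R-sym (_↭_.swap x y p) ((xy ∷ x~) ∷ y~ ∷ rs) =
  (R-sym xy ∷ All-resp-↭ p y~) ∷ All-resp-↭ p x~ ∷ AllPairs-resp-↭ R-sym p rs
AllPairs-resp-↭ R-sym (_↭_.trans p q) rs = AllPairs-resp-↭ R-sym q (AllPairs-resp-↭ R-sym p rs)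

-- Used on a colour class at a vertex: either an edge of that colour closes a triangle with the
-- vertex, or the class has lost the colour.
pair-or-none : ∀ {A : Set} {S R : A → A → Set} → (∀ x y → Dec (R x y)) → ∀ {xs} → AllPairs S xs →
               (∃[ x ] ∃[ y ] (x ∈ xs × y ∈ xs × S x y × R x y)) ⊎ AllPairs (λ x y → S x y × ¬ R x y) xs
pair-or-none R? [] = inj₂ []
pair-or-none R? {x ∷ xs} (s ∷ ss) with Any.any? (R? x) xs
... | yes r = let y , y∈ , rxy = find r in inj₁ (x , y , here refl , there y∈ , All.lookup s y∈ , rxy)
... | no ¬r with pair-or-none R? ss
...   | inj₁ (a , b , a∈ , b∈ , p) = inj₁ (a , b , there a∈ , there b∈ , p)
...   | inj₂ none = inj₂ (All.zip (s , All.¬Any⇒All¬ xs ¬r) ∷ none)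

unique⇒lookup-injective : ∀ {A : Set} {xs : List A} → Unique xs → Injective _≡_ _≡_ (List.lookup xs)
unique⇒lookup-injective (x∉ ∷ xs!) {zero}  {zero}  eq = refl
unique⇒lookup-injective (x∉ ∷ xs!) {zero}  {suc j} eq = contradiction eq (All.lookup x∉ (∈-lookup j))
unique⇒lookup-injective (x∉ ∷ xs!) {suc i} {zero}  eq = contradiction (sym eq) (All.lookup x∉ (∈-lookup i))
unique⇒lookup-injective (x∉ ∷ xs!) {suc i} {suc j} eq = cong suc (unique⇒lookup-injective xs! eq)

collect : ∀ {A B : Set} {P : A → Set} {xs} → (∀ {x} → x ∈ xs → B ⊎ P x) → B ⊎ All P xs
collect {xs = []} f = inj₂ []
collect {xs = x ∷ xs} f with f (here refl) | collect (f ∘ there)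
... | inj₁ b | _       = inj₁ b
... | inj₂ _ | inj₁ b  = inj₁ b
... | inj₂ p | inj₂ ps = inj₂ (p ∷ ps)

length-filter-∁ : ∀ {A : Set} {P : A → Set} (P? : ∀ x → Dec (P x)) xs →
                  length xs ≡ length (filter P? xs) + length (filter (¬? ∘ P?) xs)
length-filter-∁ P? [] = refl
length-filter-∁ P? (x ∷ xs) with P? x | length-filter-∁ P? xs
... | yes _ | ih = cong suc ih
... | no _  | ih = trans (cong suc ih) (sym (+-suc _ _))

-- With j + 1 colours, some class at a vertex has size at least triangleBound j
-- by pigeonhole.  If all classes have size below starBound j, then j of them
-- leave at least five vertices for the remaining one.  The value starBound 0 is
-- vacuous for an empty palette, and 5 is the least that lets class-star apply.
starBound triangleBound : ℕ → ℕ
starBound zero        = 5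
starBound (suc j)     = 6 + j * (starBound j ∸ 1)
triangleBound zero    = 2
triangleBound (suc j) = 2 + suc j * (triangleBound j ∸ 1)

5≤starBound : ∀ j → 5 ≤ starBound j
5≤starBound zero    = ≤-refl
5≤starBound (suc j) = ≤-trans (n≤1+n 5) (m≤m+n 6 _)

module RamseyColouring {n k : ℕ} (c : EdgeColouring (K n) k) where
  open EdgeColouring c
  open Colouring c

  infix 5 _without_
  _without_ : List (Fin k) → Fin k → List (Fin k)
  Q without q = filter (λ r → ¬? (r Fin.≟ q)) Q

  length-without : ∀ {j q Q} → q ∈ Q → length Q ≤ suc j → length (Q without q) ≤ j
  length-without {q = q} {Q} q∈Q Q≤j =
    s≤s⁻¹ (≤-trans (filter-notAll _ Q (Any.map (λ { refl q≢q → q≢q refl }) q∈Q)) Q≤j)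

  class : Fin n → Fin k → List (Fin n) → List (Fin n)
  class v q = filter (λ u → colour v u Fin.≟ q)

  Joined : List (Fin k) → Fin n → Fin n → Set
  Joined Q u v = u ≢ v × colour u v ∈ Q

  Joined-sym : ∀ {Q} → Symmetric (Joined Q)
  Joined-sym (u≢v , uv∈Q) = u≢v ∘ sym , subst (_∈ _) (colour-sym u≢v) uv∈Q

  -- A permutation brings `a` and `b` to the front of `C`; three further members complete the five
  -- leaves.
  class-star : ∀ {v q} C → All (λ u → v ≢ u × colour v u ≡ q) C → Unique C → 5 ≤ length C →
               ∀ {a b} → a ∈ C → b ∈ C → a ≢ b → colour a b ≡ q → Unavoidable
  class-star {v} {q} C spokes C! 5≤C {a} {b} a∈C b∈C a≢b ab
    with D , C↭aD ← extract a∈C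
    with ∈-resp-↭ C↭aD b∈C
  ... | here b≡a = contradiction (sym b≡a) a≢b
  ... | there b∈D with E , D↭bE ← extract b∈D =
    leaves E (All-resp-↭ C↭abE spokes) (AllPairs-resp-↭ (λ x≢y → x≢y ∘ sym) C↭abE C!)
      (subst (5 ≤_) (↭-length C↭abE) 5≤C)
    where
    C↭abE = ↭-trans C↭aD (↭-prep a D↭bE)
    leaves : ∀ E → All (λ u → v ≢ u × colour v u ≡ q) (a ∷ b ∷ E) → Unique (a ∷ b ∷ E) →
             5 ≤ length (a ∷ b ∷ E) → Unavoidable
    leaves (x ∷ y ∷ z ∷ E) spokes E! _ =
      mono-star (List.lookup vs) (unique⇒lookup-injective vs!) q
        (λ i → proj₂ (All.lookup (All.take⁺ 5 spokes) (∈-lookup i))) ab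
      where
      vs = v ∷ a ∷ b ∷ x ∷ y ∷ z ∷ []
      vs! : Unique vs
      vs! = AllPairs.take⁺ 6 (All.map proj₁ spokes ∷ E!)
    leaves []          _ _ (s≤s (s≤s ()))
    leaves (_ ∷ [])    _ _ (s≤s (s≤s (s≤s ())))
    leaves (_ ∷ _ ∷ []) _ _ (s≤s (s≤s (s≤s (s≤s ()))))

  -- Pigeonhole by induction on the palette: once the class of the first colour is split off, the
  -- rest uses the remaining colours and its classes are sublists of the old ones.
  class-bound : ∀ Q {v} M {B} → All (λ u → colour v u ∈ Q) M →
                (∀ {q} → q ∈ Q → length (class v q M) ≤ B) → length M ≤ length Q * B
  class-bound []      []      _        _     = z≤n
  class-bound []      (_ ∷ _) (() ∷ _) _
  class-bound (q ∷ Q) {v} M {B} ∈Q small = begin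
    length M                                ≡⟨ length-filter-∁ (λ u → colour v u Fin.≟ q) M ⟩
    length (class v q M) + length others    ≤⟨ +-mono-≤ (small (here refl)) (class-bound Q others
                                                 (All.zipWith (λ { (∈q∷Q , ≢q) → Any.tail ≢q ∈q∷Q })
                                                   (All.filter⁺ _ ∈Q , All.all-filter _ M))
                                                 λ r∈Q → ≤-trans (length-mono-≤ (⊆-filter⁺ _ _ (λ { refl p → p }) (filter-⊆ _ M)))
                                                                  (small (there r∈Q))) ⟩
    B + length Q * B                        ∎
    where
    open ≤-Reasoning
    others = filter (λ u → ¬? (colour v u Fin.≟ q)) M

  recolour : ∀ {Q q L} → AllPairs (λ u v → Joined Q u v × colour u v ≢ q) L → AllPairs (Joined (Q without q)) L
  recolour = AllPairs.map λ ((u≢v , ∈Q) , ≢q) → u≢v , ∈-filter⁺ _ ∈Q ≢q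

  Triangle : List (Fin k) → List (Fin n) → Set
  Triangle Q L = ∃[ q ] ∃[ x ] ∃[ a ] ∃[ b ] (q ∈ Q × All (_∈ L) (x ∷ a ∷ b ∷ []) ×
    AllPairs (λ u v → u ≢ v × colour u v ≡ q) (x ∷ a ∷ b ∷ []))

  -- With the first vertex as apex, one class is large; it closes a triangle or loses its colour,
  -- and induction applies. For one, two and three colours the bounds 3, 6 and 17 are the Ramsey
  -- numbers of the triangle.
  triangle : ∀ j Q L → length Q ≤ j → AllPairs (Joined Q) L → triangleBound j ≤ length L → Triangle Q L
  -- Without colours, two vertices already span an edge that cannot be coloured, hence the value 2.
  triangle zero [] (_ ∷ _ ∷ _) _ (((_ , ()) ∷ _) ∷ _) _
  triangle zero Q [] _ _ ()
  triangle zero Q (_ ∷ []) _ _ (s≤s ())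
  triangle (suc j) Q (v ∷ M) Q≤ (vM ∷ MM) (s≤s large)
    with Any.any? (λ q → triangleBound j ≤? length (class v q M)) Q
  ... | no none = contradiction (begin-strict
      length M                         ≤⟨ class-bound Q M (All.map proj₂ vM)
                                            (λ q∈Q → <⇒≤pred (≰⇒> (All.lookup (All.¬Any⇒All¬ Q none) q∈Q))) ⟩
      length Q * (triangleBound j ∸ 1) ≤⟨ *-monoˡ-≤ _ Q≤ ⟩
      suc j * (triangleBound j ∸ 1)    <⟨ large ⟩
      length M                         ∎) (<-irrefl refl)
    where open ≤-Reasoning
  ... | yes some with q , q∈Q , big ← find some
        with pair-or-none (λ u w → colour u w Fin.≟ q) (AllPairs.filter⁺ (λ u → colour v u Fin.≟ q) MM)
  ...   | inj₁ (a , b , a∈ , b∈ , (a≢b , _) , ab) =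
      let a∈M , va = ∈-filter⁻ _ a∈
          b∈M , vb = ∈-filter⁻ _ b∈
      in q , v , a , b , q∈Q , here refl ∷ there a∈M ∷ there b∈M ∷ [] ,
         ((proj₁ (All.lookup vM a∈M) , va) ∷ (proj₁ (All.lookup vM b∈M) , vb) ∷ []) ∷ ((a≢b , ab) ∷ []) ∷ [] ∷ []
  ...   | inj₂ none =
      let r , x , a , b , r∈ , ∈A , xab =
            triangle j (Q without q) (class v q M) (length-without q∈Q Q≤) (recolour none) big
      in r , x , a , b , proj₁ (∈-filter⁻ _ r∈) , All.map (there ∘ proj₁ ∘ ∈-filter⁻ _) ∈A , xab

  -- Take a triangle in colour `q` with vertex `x`. A class at `x` of size `starBound j` gives the
  -- star or loses its colour, and induction applies. If all classes are smaller, that of `q` has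
  -- five members, `a` and `b` among them. The comparison of the bounds is assumed because it first
  -- fails at five colours, 327 against 326.
  star : ∀ j Q L → (∀ {i} → i ≤ j → triangleBound i ≤ starBound i) →
         length Q ≤ j → AllPairs (Joined Q) L → starBound j ≤ length L → Unavoidable
  star zero [] (_ ∷ _ ∷ _) _ _ (((_ , ()) ∷ _) ∷ _) _
  star zero Q [] _ _ _ ()
  star zero Q (_ ∷ []) _ _ _ (s≤s ())
  star (suc j) Q L bounds Q≤ LL large
    with q , x , a , b , q∈Q , x∈L ∷ a∈L ∷ b∈L ∷ [] , ((x≢a , xa) ∷ (x≢b , xb) ∷ []) ∷ ((a≢b , ab) ∷ []) ∷ _
           ← triangle (suc j) Q L Q≤ LL (≤-trans (bounds ≤-refl) large)
    with M , L↭xM ← extract x∈L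
    with xM ∷ MM ← AllPairs-resp-↭ Joined-sym L↭xM LL
    = finish (collect small)
    where
    spokes : ∀ r → All (λ u → x ≢ u × colour x u ≡ r) (class x r M)
    spokes r = All.zip (All.filter⁺ _ (All.map proj₁ xM) , All.all-filter _ M)
    class! : ∀ r → AllPairs (Joined Q) (class x r M)
    class! r = AllPairs.filter⁺ _ MM
    big : ∀ {r} → r ∈ Q → starBound j ≤ length (class x r M) → Unavoidable
    big {r} r∈Q size with pair-or-none (λ u w → colour u w Fin.≟ r) (class! r)
    ... | inj₁ (a , b , a∈ , b∈ , (a≢b , _) , ab) =
      class-star _ (spokes r) (AllPairs.map proj₁ (class! r)) (≤-trans (5≤starBound j) size) a∈ b∈ a≢b ab
    ... | inj₂ none = star j (Q without r) _ (λ i≤j → bounds (m≤n⇒m≤1+n i≤j)) (length-without r∈Q Q≤) (recolour none) size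
    small : ∀ {r} → r ∈ Q → Unavoidable ⊎ length (class x r M) ≤ starBound j ∸ 1
    small {r} r∈Q with starBound j ≤? length (class x r M)
    ... | yes size = inj₁ (big r∈Q size)
    ... | no ¬size = inj₂ (<⇒≤pred (≰⇒> ¬size))
    in-class : ∀ {u} → u ∈ L → x ≢ u → colour x u ≡ q → u ∈ class x q M
    in-class u∈L x≢u xu = ∈-filter⁺ _ (Any.tail (x≢u ∘ sym) (∈-resp-↭ L↭xM u∈L)) xu
    finish : Unavoidable ⊎ All (λ r → length (class x r M) ≤ starBound j ∸ 1) Q → Unavoidable
    finish (inj₁ u) = u
    finish (inj₂ smalls) =
      class-star _ (spokes q) (AllPairs.map proj₁ (class! q)) 5≤class
        (in-class a∈L x≢a xa) (in-class b∈L x≢b xb) a≢b ab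
      where
      open ≤-Reasoning
      others = filter (λ u → ¬? (colour x u Fin.≟ q)) M
      others≤ : length others ≤ j * (starBound j ∸ 1)
      others≤ = begin
        length others                             ≤⟨ class-bound (Q without q) others
                                                       (All.zipWith (λ (∈Q , ≢q) → ∈-filter⁺ _ ∈Q ≢q)
                                                         (All.filter⁺ _ (All.map proj₂ xM) , All.all-filter _ M))
                                                       (λ r∈ → ≤-trans (length-mono-≤ (⊆-filter⁺ _ _ (λ { refl p → p }) (filter-⊆ _ M)))
                                                                        (All.lookup smalls (proj₁ (∈-filter⁻ _ r∈)))) ⟩
        length (Q without q) * (starBound j ∸ 1)  ≤⟨ *-monoˡ-≤ _ (length-without q∈Q Q≤) ⟩
        j * (starBound j ∸ 1)                     ∎
      -- Without `x`, the 6 in `starBound (suc j)` drops to 5; the other classes account for the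
      -- remaining summand.
      5≤class : 5 ≤ length (class x q M)
      5≤class = +-cancelʳ-≤ (j * (starBound j ∸ 1)) 5 _ (begin
        5 + j * (starBound j ∸ 1)                     ≤⟨ s≤s⁻¹ (≤-trans large (≤-reflexive (↭-length L↭xM))) ⟩
        length M                                      ≡⟨ length-filter-∁ (λ u → colour x u Fin.≟ q) M ⟩
        length (class x q M) + length others          ≤⟨ +-monoʳ-≤ _ others≤ ⟩
        length (class x q M) + j * (starBound j ∸ 1)  ∎)

  three-colours : 26 ≤ n → k ≤ 3 → Unavoidable
  three-colours 26≤n k≤3 = star 3 (allFin k) (allFin n) bounds
    (subst (_≤ 3) (sym (length-tabulate _)) k≤3)
    (AllPairs.map (λ u≢v → u≢v , ∈-allFin _) (Unique.allFin⁺ n))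
    (subst (26 ≤_) (sym (length-tabulate _)) 26≤n)
    where
    bounds : ∀ {i} → i ≤ 3 → triangleBound i ≤ starBound i
    -- The pairs compared are 2 and 5, 3 and 6, 6 and 11, 17 and 26.
    bounds {0} _ = m≤m+n 2 3
    bounds {1} _ = m≤m+n 3 3
    bounds {2} _ = m≤m+n 6 5
    bounds {3} _ = m≤m+n 17 9
    bounds {suc (suc (suc (suc _)))} (s≤s (s≤s (s≤s ())))

-- Colourings for the lower bounds.

Avoids : ∀ {n k} → EdgeColouring (K n) k → Set
Avoids c = ¬ Colouring.Unavoidable c

path-edge : ∀ (i : Fin 4) → Graph._~_ (P 5) (inject₁ i) (suc i)
path-edge i = fwd (cong suc (sym (Fin.toℕ-inject₁ i)))

path-edge-injective : ∀ {i j : Fin 4} → SameEdge (inject₁ i) (suc i) (inject₁ j) (suc j) → i ≡ j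
path-edge-injective (inj₁ (_ , eq)) = Fin.suc-injective eq
path-edge-injective {i} {j} (inj₂ (i≡1+j , 1+i≡j)) = contradiction
  (trans (sym (cong suc (trans (sym (Fin.toℕ-inject₁ i)) (cong toℕ i≡1+j))))
         (trans (cong toℕ 1+i≡j) (Fin.toℕ-inject₁ j)))
  (<⇒≢ (m<n⇒m<1+n (n<1+n (toℕ j))) ∘ sym)

few-colours⇒¬rainbow : ∀ {n k} (c : EdgeColouring (K n) k) → k < 4 → ∀ f → ¬ Rainbow {P 5} c f
few-colours⇒¬rainbow c k<4 f rainbow =
  let i , j , i<j , eq = Fin.pigeonhole k<4 (λ i → colour (embed (inject₁ i)) (embed (suc i)))
  in Fin.<⇒≢ i<j (path-edge-injective (rainbow (path-edge i) (path-edge j) eq))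
  where open EdgeColouring c
        open Copy f

spoke : ∀ (i : Fin 5) → Graph._~_ (S 6 1) zero (suc i)
spoke i = fwd (inj₁ (refl , λ ()))

leaf-edge : Graph._~_ (S 6 1) 1F 2F
leaf-edge = fwd (inj₂ (0 , s≤s z≤n , refl , refl))

-- Sides of the pentagon get one colour and its diagonals another; the third colour, on equal
-- arguments, is the one inside a block of the blow-up.
pentagon : Fin 5 → Fin 5 → Fin 3
pentagon a b =
  if does (a Fin.≟ b) then 2F
  else if (suc (toℕ a) % 5 ≡ᵇ toℕ b) ∨ (suc (toℕ b) % 5 ≡ᵇ toℕ a) then 0F
  else 1F

pentagon-sym : ∀ a b → pentagon a b ≡ pentagon b a
pentagon-sym = from-yes (Fin.all? λ a → Fin.all? λ b → pentagon a b Fin.≟ pentagon b a)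

pentagon-diagonal : ∀ a b → pentagon a b ≡ 2F → a ≡ b
pentagon-diagonal = from-yes (Fin.all? λ a → Fin.all? λ b → (pentagon a b Fin.≟ 2F) →-dec (a Fin.≟ b))

-- Neither the pentagon nor its complement contains a triangle.
pentagon-triangle : ∀ a b d → pentagon a b ≡ pentagon a d → pentagon b d ≡ pentagon a d → pentagon a d ≡ 2F
pentagon-triangle = from-yes (Fin.all? λ a → Fin.all? λ b → Fin.all? λ d →
  (pentagon a b Fin.≟ pentagon a d) →-dec (pentagon b d Fin.≟ pentagon a d) →-dec (pentagon a d Fin.≟ 2F))

blownUpPentagon : EdgeColouring (K 25) 3
blownUpPentagon = record
  { colour     = λ u v → pentagon (quotient {5} 5 u) (quotient {5} 5 v)
  ; colour-sym = λ {u} {v} _ → pentagon-sym (quotient {5} 5 u) (quotient {5} 5 v) }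

blownUpPentagon-exact : Exact blownUpPentagon
blownUpPentagon-exact 0F = combine {5} {5} 0F 0F , combine {5} {5} 1F 0F , (λ ()) , refl
blownUpPentagon-exact 1F = combine {5} {5} 0F 0F , combine {5} {5} 2F 0F , (λ ()) , refl
blownUpPentagon-exact 2F = combine {5} {5} 0F 0F , combine {5} {5} 0F 1F , (λ ()) , refl

-- The triangle in the star forces the block colour, which places all six vertices in a single block
-- of five.
blownUpPentagon-avoids : Avoids blownUpPentagon
blownUpPentagon-avoids (inj₁ (f , rainbow)) = few-colours⇒¬rainbow blownUpPentagon ≤-refl f rainbow
blownUpPentagon-avoids (inj₂ (f , q , mono)) = <⇒≱ (n<1+n 5) (Fin.injective⇒≤ rem-injective)
  where
  open Copy f
  block : Fin 6 → Fin 5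
  block i = quotient {5} 5 (embed i)
  q≡2 : pentagon (block 0F) (block 2F) ≡ 2F
  q≡2 = pentagon-triangle (block 0F) (block 1F) (block 2F)
    (trans (mono (spoke 0F)) (sym (mono (spoke 1F)))) (trans (mono leaf-edge) (sym (mono (spoke 1F))))
  same-block : ∀ i → block 0F ≡ block i
  same-block zero    = refl
  same-block (suc i) = pentagon-diagonal (block 0F) (block (suc i))
    (trans (mono (spoke i)) (trans (sym (mono (spoke 1F))) q≡2))
  rem-injective : Injective _≡_ _≡_ (λ i → remainder {5} 5 (embed i))
  rem-injective {i} {j} eq = injective (begin
    embed i                                        ≡⟨ Fin.combine-remQuot {5} 5 (embed i) ⟨
    combine (block i) (remainder {5} 5 (embed i))  ≡⟨ cong₂ combine (trans (sym (same-block i)) (same-block j)) eq ⟩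
    combine (block j) (remainder {5} 5 (embed j))  ≡⟨ Fin.combine-remQuot {5} 5 (embed j) ⟩
    embed j                                        ∎)
    where open ≡-Reasoning

-- A monochromatic K₅ and one more vertex, the hub, whose five edges carry the other `suc m`
-- colours; this is possible as `m ≤ 4`.
module Hub (m : ℕ) (m≤4 : m ≤ 4) where

  clamp : Fin 5 → Fin (suc m)
  clamp i = fromℕ< (s≤s (m⊓n≤n (toℕ i) m))

  clamp-surjective : ∀ q → ∃[ i ] clamp i ≡ q
  clamp-surjective q = inject≤ q (s≤s m≤4) , Fin.toℕ-injective (begin
    toℕ (clamp (inject≤ q _))      ≡⟨ Fin.toℕ-fromℕ< _ ⟩
    toℕ (inject≤ q _) ⊓ m          ≡⟨ cong (_⊓ m) (Fin.toℕ-inject≤ q _) ⟩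
    toℕ q ⊓ m                      ≡⟨ m≤n⇒m⊓n≡m (s≤s⁻¹ (Fin.toℕ<n q)) ⟩
    toℕ q                          ∎)
    where open ≡-Reasoning

  hubColour : Fin 6 → Fin 6 → Fin (2 + m)
  hubColour zero    (suc i) = suc (clamp i)
  hubColour (suc i) zero    = suc (clamp i)
  hubColour _       _       = zero

  hub : EdgeColouring (K 6) (2 + m)
  hub = record { colour = hubColour ; colour-sym = λ {u} {v} _ → hubColour-sym u v }
    where
    hubColour-sym : ∀ u v → hubColour u v ≡ hubColour v u
    hubColour-sym zero    zero    = refl
    hubColour-sym zero    (suc _) = refl
    hubColour-sym (suc _) zero    = refl
    hubColour-sym (suc _) (suc _) = refl

  hub-exact : Exact hub
  hub-exact zero    = 1F , 2F , (λ ()) , refl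
  hub-exact (suc q) = let i , eq = clamp-surjective q in 0F , suc i , (λ ()) , cong suc eq

  off-hub : ∀ {u v} → u ≢ 0F → v ≢ 0F → hubColour u v ≡ zero
  off-hub {zero}          u≢0 _   = contradiction refl u≢0
  off-hub {suc _} {zero}  _   v≢0 = contradiction refl v≢0
  off-hub {suc _} {suc _} _   _   = refl

  at-hub : ∀ {v} → v ≢ 0F → hubColour 0F v ≢ zero
  at-hub {zero}  v≢0 = contradiction refl v≢0
  at-hub {suc _} _   = λ ()

  -- A vertex lies on at most two of the four edges of the path, so two edges avoid the hub and
  -- share the colour `zero`.
  hub-¬rainbow : ∀ f → ¬ Rainbow {P 5} hub f
  hub-¬rainbow f rainbow = cases (embed 0F Fin.≟ 0F) (embed 1F Fin.≟ 0F) (embed 2F Fin.≟ 0F)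
    where
    open Copy f
    clash : ∀ i j → i ≢ j → embed (inject₁ i) ≢ 0F → embed (suc i) ≢ 0F →
            embed (inject₁ j) ≢ 0F → embed (suc j) ≢ 0F → ⊥
    clash i j i≢j a b c d = i≢j (path-edge-injective
      (rainbow (path-edge i) (path-edge j) (trans (off-hub a b) (sym (off-hub c d)))))
    others : ∀ {i j} → embed i ≡ 0F → i ≢ j → embed j ≢ 0F
    others i↦0 i≢j j↦0 = i≢j (injective (trans i↦0 (sym j↦0)))
    cases : Dec (embed 0F ≡ 0F) → Dec (embed 1F ≡ 0F) → Dec (embed 2F ≡ 0F) → ⊥
    cases (yes e) _ _ = clash 2F 3F (λ ()) (others e λ ()) (others e λ ()) (others e λ ()) (others e λ ())
    cases (no _) (yes e) _ = clash 2F 3F (λ ()) (others e λ ()) (others e λ ()) (others e λ ()) (others e λ ())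
    cases (no a) (no b) (yes e) = clash 0F 3F (λ ()) a b (others e λ ()) (others e λ ())
    -- The hub is at one of the last two positions or is missed, so the first two edges avoid it.
    cases (no a) (no b) (no d) = clash 0F 1F (λ ()) a b b d

  -- Six vertices do not fit into the K₅, so the hub is used. As centre it clashes with the edge
  -- between leaves, as leaf with any spoke to another leaf.
  hub-¬mono : ∀ f → ¬ Monochromatic {S 6 1} hub f
  hub-¬mono f (q , mono) with Fin.any? (λ i → Copy.embed f i Fin.≟ 0F)
  ... | no ¬hit = <⇒≱ (n<1+n 5) (Fin.injective⇒≤ {f = λ i → punchOut (avoid i)}
                    λ eq → injective (Fin.punchOut-injective (avoid _) (avoid _) eq))
    where
    open Copy f
    avoid : ∀ i → 0F ≢ embed i
    avoid i eq = ¬hit (i , sym eq)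
  ... | yes (zero , e) = at-hub (others λ ()) (begin
      hubColour 0F (embed 1F)          ≡⟨ cong (λ v → hubColour v (embed 1F)) e ⟨
      hubColour (embed 0F) (embed 1F)  ≡⟨ mono (spoke 0F) ⟩
      q                                ≡⟨ mono leaf-edge ⟨
      hubColour (embed 1F) (embed 2F)  ≡⟨ off-hub (others λ ()) (others λ ()) ⟩
      zero                             ∎)
    where
    open Copy f
    open ≡-Reasoning
    others : ∀ {j} → 0F ≢ j → embed j ≢ 0F
    others 0≢j j↦0 = 0≢j (injective (trans e (sym j↦0)))
  ... | yes (suc i , e) = at-hub (others {0F} λ ()) (begin
      hubColour 0F (embed 0F)               ≡⟨ EdgeColouring.colour-sym hub {0F} {embed 0F} (others {0F} (λ ()) ∘ sym) ⟩
      hubColour (embed 0F) 0F               ≡⟨ cong (hubColour (embed 0F)) e ⟨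
      hubColour (embed 0F) (embed (suc i))  ≡⟨ mono (spoke i) ⟩
      q                                     ≡⟨ proj₂ (proj₂ (another i)) ⟨
      hubColour (embed 0F) (embed (suc (proj₁ (another i)))) ≡⟨ off-hub (others λ ()) (others (proj₁ (proj₂ (another i)))) ⟩
      zero                                  ∎)
    where
    open Copy f
    open ≡-Reasoning
    others : ∀ {j} → suc i ≢ j → embed j ≢ 0F
    others i≢j j↦0 = i≢j (injective (trans e (sym j↦0)))
    another : ∀ (i : Fin 5) → ∃[ j ] (Fin.suc i ≢ suc j × hubColour (embed 0F) (embed (suc j)) ≡ q)
    another zero    = 1F , (λ ()) , mono (spoke 1F)
    another (suc _) = 0F , (λ ()) , mono (spoke 0F)

  hub-avoids : Avoids hub
  hub-avoids (inj₁ (f , rainbow)) = hub-¬rainbow f rainbow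
  hub-avoids (inj₂ (f , mono))    = hub-¬mono f mono

-- Binomial coefficients and the ceiling formula.

2*[1+n]C2≡n*[1+n] : ∀ n → 2 * (suc n C 2) ≡ n * suc n
2*[1+n]C2≡n*[1+n] zero    = refl
2*[1+n]C2≡n*[1+n] (suc n) = begin
  2 * (suc (suc n) C 2)          ≡⟨ cong (2 *_) (nCk+nC[k+1]≡[n+1]C[k+1] (suc n) 1) ⟨
  2 * (suc n C 1 + suc n C 2)    ≡⟨ cong (λ a → 2 * (a + suc n C 2)) (nC1≡n (suc n)) ⟩
  2 * (suc n + suc n C 2)        ≡⟨ *-distribˡ-+ 2 (suc n) (suc n C 2) ⟩
  2 * suc n + 2 * (suc n C 2)    ≡⟨ cong (λ a → 2 * suc n + a) (2*[1+n]C2≡n*[1+n] n) ⟩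
  2 * suc n + n * suc n          ≡⟨ *-distribʳ-+ (suc n) 2 n ⟨
  (2 + n) * suc n                ≡⟨ *-comm (2 + n) (suc n) ⟩
  suc n * suc (suc n)            ∎
  where open ≡-Reasoning

n≤[1+n]C2 : ∀ {n} → 1 ≤ n → n ≤ suc n C 2
n≤[1+n]C2 {n} 1≤n = *-cancelˡ-≤ 2 (begin
  2 * n            ≡⟨ *-comm 2 n ⟩
  n * 2            ≤⟨ *-monoʳ-≤ n (s≤s 1≤n) ⟩
  n * suc n        ≡⟨ 2*[1+n]C2≡n*[1+n] n ⟨
  2 * (suc n C 2)  ∎)
  where open ≤-Reasoning

least : ∀ {P : ℕ → Set} → Decidable P → ∀ {n} → P n → ∃[ m ] (P m × (∀ {i} → P i → m ≤ i))
least P? {zero} p = 0 , p , λ _ → z≤n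
least {P} P? {suc n} p with P? 0
... | yes p₀ = 0 , p₀ , λ _ → z≤n
... | no ¬p₀ with m , pₘ , min ← least {λ i → P (suc i)} (λ i → P? (suc i)) {n} p =
  suc m , pₘ , λ { {zero} p₀ → contradiction p₀ ¬p₀ ; {suc i} pᵢ → s≤s (min pᵢ) }

-- Completing the square: (2t + 1)² = 1 + 4t(t + 1) = 1 + 8 * ((1 + t) C 2).
square : ∀ t → (t + suc t) * (t + suc t) ≡ 1 + 8 * (suc t C 2)
square t = begin
  (t + suc t) * (t + suc t)      ≡⟨ expand t ⟩
  1 + 4 * (t * suc t)            ≡⟨ cong (λ a → 1 + 4 * a) (2*[1+n]C2≡n*[1+n] t) ⟨
  1 + 4 * (2 * (suc t C 2))      ≡⟨ cong suc (*-assoc 4 2 (suc t C 2)) ⟨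
  1 + 8 * (suc t C 2)            ∎
  where
  open ≡-Reasoning
  expand : ∀ t → (t + suc t) * (t + suc t) ≡ 1 + 4 * (t * suc t)
  expand = solve-∀

module _ (k : ℕ) where

  root : UpperReal
  root = (1+ᴿ (√ (1 + 8 * k))) /2

  -- The point at which the cut of the square root is tested when `root` is evaluated at `suc t`.
  2[1+t]-1 : ℕ → ℚᵘ.ℚᵘ
  2[1+t]-1 t = + suc t ℚᵘ./ 1 ℚᵘ.+ + suc t ℚᵘ./ 1 ℚᵘ.- ℚᵘ.1ℚᵘ

  numerator : ∀ t → 2[1+t]-1 t ≡ mkℚᵘ (+ (t + suc t)) 0
  numerator t = cong (λ a → mkℚᵘ (+ a) 0) (trans (*-identityʳ (t * 1 + suc (t * 1)))
                                                 (cong (λ a → a + suc a) (*-identityʳ t)))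

  -- The cut says that 1 + 8k is at most the square of 2t + 1, which `square` rewrites as
  -- `1 + 8 * (suc t C 2)`.
  root≤⇒≤C : ∀ t → root (+ suc t ℚᵘ./ 1) → k ≤ suc t C 2
  root≤⇒≤C t (_ , le) = *-cancelˡ-≤ 8 (s≤s⁻¹ (subst (1 + 8 * k ≤_) (square t) le′))
    where
    le′ : 1 + 8 * k ≤ (t + suc t) * (t + suc t)
    le′ with *≤* p ← subst (λ q → + (1 + 8 * k) ℚᵘ./ 1 ℚᵘ.≤ q ℚᵘ.* q) (numerator t) le =
      ℤ.drop‿+≤+ (subst₂ ℤ._≤_ (ℤ.*-identityʳ _)
        (trans (ℤ.*-identityʳ _) (sym (ℤ.pos-* (t + suc t) (t + suc t)))) p)

  ≤C⇒root≤ : ∀ t → k ≤ suc t C 2 → root (+ suc t ℚᵘ./ 1)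
  ≤C⇒root≤ t k≤ = subst (λ q → ℚᵘ.0ℚᵘ ℚᵘ.≤ q × + (1 + 8 * k) ℚᵘ./ 1 ℚᵘ.≤ q ℚᵘ.* q) (sym (numerator t))
    ( *≤* (subst (ℤ.0ℤ ℤ.≤_) (sym (ℤ.*-identityʳ (+ (t + suc t)))) (ℤ.+≤+ z≤n))
    , *≤* (subst₂ ℤ._≤_ (sym (ℤ.*-identityʳ _))
        (sym (trans (ℤ.*-identityʳ _) (sym (ℤ.pos-* (t + suc t) (t + suc t)))))
        (ℤ.+≤+ (subst (1 + 8 * k ≤_) (sym (square t)) (s≤s (*-monoʳ-≤ 8 k≤))))))

  root-ceiling : ∀ {N} → 1 ≤ N → k ≤ N C 2 → (∀ {M} → k ≤ M C 2 → N ≤ M) → ⌈ root ⌉≔ + N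
  root-ceiling {suc t} _ k≤ min = ≤C⇒root≤ t k≤ , below
    where
    below : ∀ m → root (m ℚᵘ./ 1) → + suc t ℤ.≤ m
    below (+ suc s)  r                = ℤ.+≤+ (min (root≤⇒≤C s r))
    -- For an integer below 1, doubling and subtracting 1 gives a negative number, which the cut of
    -- a square root excludes.
    below (+ zero)   (*≤* () , _)
    below -[1+ s ]   (*≤* () , _)

-- The values of the Gallai-Ramsey number.

avoided⇒< : ∀ {k n M} → GallaiRamseyBound k (P 5) (S 6 1) M →
            (c : EdgeColouring (K n) k) → Exact c → Avoids c → n < M
avoided⇒< (_ , unavoidable) c exact avoids = ≰⇒> λ M≤n → avoids (unavoidable _ M≤n c exact)

gr-three : gr 3 ⦅ P 5 ∶ S 6 1 ⦆≔ 26
-- `26 C 2` is 325, that is 3 + 322.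
gr-three = (m≤m+n 3 322 , λ n 26≤n c _ → RamseyColouring.three-colours c 26≤n ≤-refl)
         , λ M bound → avoided⇒< bound blownUpPentagon blownUpPentagon-exact blownUpPentagon-avoids

gr-four-to-six : ∀ {k} → 4 ≤ k → k ≤ 6 → gr k ⦅ P 5 ∶ S 6 1 ⦆≔ 7
gr-four-to-six {suc (suc m)} 4≤k@(s≤s (s≤s _)) k≤6@(s≤s (s≤s m≤4)) =
    -- `7 C 2` is 21, that is 6 + 15.
    (≤-trans k≤6 (m≤m+n 6 15) , λ n 7≤n c exact → four-colours {c = c} exact 7≤n 4≤k)
  , λ M bound → avoided⇒< bound hub hub-exact hub-avoids
  where open Hub m m≤4

7≤nC2⇒5≤n : ∀ {n} → 7 ≤ n C 2 → 5 ≤ n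
7≤nC2⇒5≤n {0} ()
7≤nC2⇒5≤n {1} ()
7≤nC2⇒5≤n {2} (s≤s ())
7≤nC2⇒5≤n {3} (s≤s (s≤s (s≤s ())))
7≤nC2⇒5≤n {4} (s≤s (s≤s (s≤s (s≤s (s≤s (s≤s ()))))))
7≤nC2⇒5≤n {suc (suc (suc (suc (suc n))))} _ = m≤m+n 5 n

-- The lower bound is pure counting: `N` is the least order whose edges can carry `k` colours. As
-- `4 C 2` is 6, that order is at least five, where the search applies.
gr-seven-or-more : ∀ {k} → 7 ≤ k →
                   ∃[ N ] (⌈ (1+ᴿ (√ (1 + 8 * k))) /2 ⌉≔ + N × gr k ⦅ P 5 ∶ S 6 1 ⦆≔ N)
gr-seven-or-more {k} 7≤k
  with N , k≤NC2 , min ← least (λ N → k ≤? N C 2) {suc k} (n≤[1+n]C2 (≤-trans z<s 7≤k)) =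
    N , root-ceiling k (≤-trans (m≤m+n 1 4) 5≤N) k≤NC2 min
      , (k≤NC2 , λ n N≤n c exact → seven-colours {c = c} exact (≤-trans 5≤N N≤n) 7≤k)
      , λ M (k≤MC2 , _) → min k≤MC2
  where
  5≤N = 7≤nC2⇒5≤n (≤-trans 7≤k k≤NC2)

theorem3p8 : ∀ (k : ℕ) → 3 ≤ k →
    (k ≡ 3 → gr k ⦅ P 5 ∶ S 6 1 ⦆≔ 26) ×
    (4 ≤ k → k ≤ 6 → gr k ⦅ P 5 ∶ S 6 1 ⦆≔ 7) ×
    (7 ≤ k → ∃[ N ] (⌈ (1+ᴿ (√ (1 + 8 * k))) /2 ⌉≔ + N × gr k ⦅ P 5 ∶ S 6 1 ⦆≔ N))
theorem3p8 k _ = (λ { refl → gr-three }) , gr-four-to-six , gr-seven-or-more
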